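{- Let $G$ be a bipartite multigraph (multiple edges allowed, no loops) with maximum degree $\Delta(G)$, and let the palette be $\mathcal{K}=\{1,\dots,\Delta(G)+1\}$. Let $M\subseteq E(G)$ be a matching whose edges are assigned arbitrary colours from $\mathcal{K}$. Then this precolouring can be extended to a proper edge-colouring of all of $G$ using only colours from $\mathcal{K}$.
   Context: A proper edge-colouring assigns colours to edges so that any two edges sharing an end-vertex (including parallel edges) receive distinct colours. Extending a precolouring means producing a proper edge-colouring of all of $G$ agreeing with the given colours on the precoloured edges. -}

module Defs where

open import Data.Nat using (ℕ; suc; _⊔_)
open import Data.Fin using (Fin)
open import Data.Fin.Properties using (_≟_)
open import Data.Bool using (Bool; true; false; not)
open import Data.Maybe using (Maybe; just; nothing)
open import Data.Product using (_×_; _,_; proj₁; proj₂)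
open import Data.List using (List; length; filter; foldr; map)
open import Data.List.Base using (allFin)
open import Data.Sum using (_⊎_)
open import Relation.Binary.PropositionalEquality using (_≡_; _≢_)
open import Relation.Nullary using (¬_)

-- A multigraph on vertex set Fin n with m edges (labelled by Fin m);
-- edge e joins the two vertices in  ends e.  Parallel edges = distinct
-- edge labels with the same ends.
record Multigraph (n m : ℕ) : Set where
  field
    ends   : Fin m → Fin n × Fin n
    noLoop : ∀ e → proj₁ (ends e) ≢ proj₂ (ends e)
open Multigraph public

_isEndOf_within_ : ∀ {n m} → Fin n → Fin m → Multigraph n m → Set
v isEndOf e within G = (v ≡ proj₁ (ends G e)) ⊎ (v ≡ proj₂ (ends G e))

Adjacent : ∀ {n m} → Multigraph n m → Fin m → Fin m → Set
Adjacent G e f = Data.Product.Σ _ λ v → (v isEndOf e within G) × (v isEndOf f within G)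

Bipartite : ∀ {n m} → Multigraph n m → Set
Bipartite {n} G = Data.Product.Σ (Fin n → Bool) λ side →
  ∀ e → side (proj₁ (ends G e)) ≡ not (side (proj₂ (ends G e)))

-- degree of v: number of edges incident to v (no loops, so each edge counts once)
incident? : ∀ {n m} → Multigraph n m → Fin n → Fin m → Bool
incident? G v e with v ≟ proj₁ (ends G e) | v ≟ proj₂ (ends G e)
... | Relation.Nullary.yes _ | _ = true
... | Relation.Nullary.no _ | Relation.Nullary.yes _ = true
... | Relation.Nullary.no _ | Relation.Nullary.no _ = false

degree : ∀ {n m} → Multigraph n m → Fin n → ℕ
degree {n} {m} G v = length (filter (λ e → Data.Bool.T? (incident? G v e)) (allFin m))

maxDegree : ∀ {n m} → Multigraph n m → ℕ
maxDegree {n} G = foldr _⊔_ 0 (map (degree G) (allFin n))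

ProperEdgeColouring : ∀ {n m} {C : Set} → Multigraph n m → (Fin m → C) → Set
ProperEdgeColouring G c = ∀ e f → e ≢ f → Adjacent G e f → c e ≢ c f

-- a precolouring: pre e = just k means e ∈ M with colour k; nothing means e ∉ M.
-- M (the set of precoloured edges) is a matching.
PrecolouredIsMatching : ∀ {n m} {C : Set} → Multigraph n m → (Fin m → Maybe C) → Set
PrecolouredIsMatching G pre =
  ∀ e f {a b} → pre e ≡ just a → pre f ≡ just b → e ≢ f → ¬ Adjacent G e f

Extends : ∀ {m} {C : Set} → (Fin m → C) → (Fin m → Maybe C) → Set
Extends c pre = ∀ e {a} → pre e ≡ just a → c e ≡ a

{-# OPTIONS --safe #-}
module Submission where

open import Defs
open import Data.Nat using (ℕ; suc)
open import Data.Fin using (Fin)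
open import Data.Maybe using (Maybe)
open import Data.Product using (Σ; _×_)

open import Data.Bool using (Bool; true; false; if_then_else_)
import Data.Bool as Bool
open import Data.Bool.Properties using (not-¬)
open import Data.Empty using (⊥-elim)
open import Data.Fin using (zero; suc; fromℕ; inject₁; _<_; _≤_; _>_)
open import Data.Fin.Induction using (>-wellFounded)
open import Data.Fin.Permutation.Components using (transpose; transpose-inverse)
open import Data.Fin.Properties using
  ( _≟_; _<?_; _≤?_; any?; 0≢1+n; suc-injective; inject₁-injective; fromℕ≢inject₁; ≤fromℕ
  ; <-cmp; <-trans; <-irrefl; injective⇒≤)
open import Data.Fin.Subset using
  (Subset; inside; outside; ⊥; ⊤; ⁅_⁆; ∁; _∈_; _∉_; _⊆_; _⊂_; _⊃_; _∪_; _∩_; _-_; ∣_∣)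
open import Data.Fin.Subset.Induction using (Acc; acc; ⊂-wellFounded; ⊃-wellFounded)
open import Data.Fin.Subset.Properties using
  ( _∈?_; ∈⊤; x∈⁅x⁆; x∈⁅y⁆⇒x≡y; x∉p⇒x∈∁p; p⊆p∪q; q⊆p∪q; x∈p∪q⁻; x∈p∩q⁺; x∈p∩q⁻
  ; x∈p⇒p-x⊂p; x∈p∧x≢y⇒x∈p-y; p─q⊆p; x∈p⇒∣p-x∣<∣p∣; p⊆q⇒∣p∣≤∣q∣; p⊂q⇒∣p∣<∣q∣
  ; ∣⊤∣≡n; ∣⊥∣≡0; ∣⁅x⁆∣≡1; ∣p∣≤n; ∣∁p∣≡n∸∣p∣)
open import Data.List using (List; []; _∷_; allFin; filter; foldr; lookup)
open import Data.List.Membership.Propositional using () renaming (_∈_ to _∈ˡ_)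
open import Data.List.Membership.Propositional.Properties using (∈-allFin; ∈-filter⁺; ∈-map⁺)
open import Data.List.Relation.Unary.Any using (here; there; index) renaming (any? to anyˡ?)
open import Data.List.Relation.Unary.Any.Properties using (lookup-index)
open import Data.Maybe using (just; nothing; maybe′)
import Data.Nat as ℕ
import Data.Nat.Properties as ℕ
open import Data.Product using (∃; _,_; proj₁; proj₂)
open import Data.Sum using (_⊎_; inj₁; inj₂; [_,_]′)
open import Data.Unit using (tt)
open import Data.Vec using ([]; _∷_; here; there; tail; tabulate)
open import Data.Vec.Functional using (updateAt)
open import Data.Vec.Functional.Properties using (updateAt-updates; updateAt-minimal)
open import Data.Vec.Properties using (lookup⇒[]=; []=⇒lookup; lookup∘tabulate)
open import Function using (_∘_; const)
open import Relation.Binary using (tri<; tri≈; tri>) renaming (Decidable to Decidable₂)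
open import Relation.Binary.PropositionalEquality
  using (_≡_; _≢_; refl; sym; trans; cong; subst)
open import Relation.Nullary using (¬_; Dec; yes; no; does)
open import Relation.Nullary.Decidable using (_×-dec_; _⊎-dec_; ¬?; dec-true; decidable-stable)
open import Relation.Unary using (Decidable)

-- Give every precoloured edge the pseudo-colour Δ at its end in the first class X and 0
-- at its end in the second class Y. Inserting the other edges one at a time, Kempe swaps
-- extend this to ranks 0 … Δ, one per remaining edge, that are injective around every
-- vertex: the new edge needs a rank α ≠ 0 free at its X-end and a rank β ≠ Δ free at its
-- Y-end, both of which exist by the degree bound, and swapping α and β on the chain that
-- leaves the X-end along β then never meets a pseudo-colour.
--
-- Now run Galvin's list-colouring argument on the whole graph, X-ends preferring large
-- ranks and Y-ends small ones, with the list {pre e} for a precoloured edge and the full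
-- palette otherwise. A precoloured edge has no better neighbour, while an edge of rank r
-- has at most (Δ − r) + r = Δ of them, so each list is longer than the number of better
-- neighbours.

-- Finite subsets and their cardinalities.

subset : ∀ {n} {P : Fin n → Set} → Decidable P → Subset n
subset P? = tabulate (does ∘ P?)

∈-subset⁺ : ∀ {n} {P : Fin n → Set} (P? : Decidable P) {i} → P i → i ∈ subset P?
∈-subset⁺ P? {i} p = lookup⇒[]= i _ (trans (lookup∘tabulate _ i) (dec-true (P? i) p))

∈-subset⁻ : ∀ {n} {P : Fin n → Set} (P? : Decidable P) {i} → i ∈ subset P? → P i
∈-subset⁻ P? {i} i∈ with P? i | trans (sym (lookup∘tabulate (does ∘ P?) i)) ([]=⇒lookup i∈)
... | yes p | _ = p

∣p∣≡∣tail∣ : ∀ {q} (p : Subset (suc q)) → zero ∉ p → ∣ p ∣ ≡ ∣ tail p ∣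
∣p∣≡∣tail∣ (inside ∷ p) 0∉p = ⊥-elim (0∉p here)
∣p∣≡∣tail∣ (outside ∷ p) _ = refl

∣p∣≤1+∣tail∣ : ∀ {q} (p : Subset (suc q)) → ∣ p ∣ ℕ.≤ suc ∣ tail p ∣
∣p∣≤1+∣tail∣ (inside ∷ p) = ℕ.≤-refl
∣p∣≤1+∣tail∣ (outside ∷ p) = ℕ.n≤1+n _

-- Recursion on `p` deletes from `q` the image of each element met. Injectivity is asked on `p`
-- only, because ranks will be injective just around a single vertex.
injection⇒∣p∣≤∣q∣ : ∀ {m k} (f : Fin m → Fin k) (p : Subset m) (q : Subset k) →
  (∀ {i} → i ∈ p → f i ∈ q) → (∀ {i j} → i ∈ p → j ∈ p → f i ≡ f j → i ≡ j) → ∣ p ∣ ℕ.≤ ∣ q ∣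
injection⇒∣p∣≤∣q∣ f [] q _ _ = ℕ.z≤n
injection⇒∣p∣≤∣q∣ f (outside ∷ p) q into inj =
  injection⇒∣p∣≤∣q∣ (f ∘ suc) p q (into ∘ there)
    λ i∈p j∈p → suc-injective ∘ inj (there i∈p) (there j∈p)
injection⇒∣p∣≤∣q∣ f (inside ∷ p) q into inj = ℕ.≤-trans
  (ℕ.s≤s (injection⇒∣p∣≤∣q∣ (f ∘ suc) p (q - f zero)
    (λ i∈p → x∈p∧x≢y⇒x∈p-y (into (there i∈p)) (0≢1+n ∘ sym ∘ inj (there i∈p) here))
    (λ i∈p j∈p → suc-injective ∘ inj (there i∈p) (there j∈p))))
  (x∈p⇒∣p-x∣<∣p∣ (into here))

-- The elements above `i` lie in the complement of `upTo`, and those below lie in `upTo` but miss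
-- `i`; that one missing element gives the strict inequality.
∣above∣+∣below∣<n : ∀ {n} (i : Fin n) →
  ∣ subset {n} (λ j → i <? j) ∣ ℕ.+ ∣ subset {n} (λ j → j <? i) ∣ ℕ.< n
∣above∣+∣below∣<n {n} i = ℕ.<-≤-trans
  (ℕ.+-mono-≤-<
    (p⊆q⇒∣p∣≤∣q∣ {q = ∁ upTo}
      (λ j∈ → x∉p⇒x∈∁p (ℕ.<⇒≱ (∈-subset⁻ (λ j → i <? j) j∈) ∘ ∈-subset⁻ (λ j → j ≤? i))))
    (p⊂q⇒∣p∣<∣q∣ {q = upTo}
      ( (λ {j} j∈ → ∈-subset⁺ (λ j → j ≤? i) (ℕ.<⇒≤ (∈-subset⁻ (λ j → j <? i) j∈)))
      , i , ∈-subset⁺ (λ j → j ≤? i) ℕ.≤-refl , <-irrefl {x = i} refl ∘ ∈-subset⁻ (λ j → j <? i))))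
  (ℕ.≤-reflexive (trans (cong (ℕ._+ ∣ upTo ∣) (∣∁p∣≡n∸∣p∣ upTo)) (ℕ.m∸n+n≡m (∣p∣≤n upTo))))
  where
  upTo = subset (λ j → j ≤? i)

-- Chains of an injective relation.

record Chain {n} (R : Fin n → Fin n → Set) (s : Fin n) : Set where
  field
    members  : Subset n
    start    : s ∈ members
    forward  : ∀ {u v} → R u v → u ∈ members → v ∈ members
    backward : ∀ {u v} → R u v → v ∈ members → u ∈ members
    -- For Kempe chains the two closure properties keep swapped edges from clashing with unswapped
    -- ones, while the predecessor supplies edges showing which colours were already present at a
    -- vertex before the swap.
    reached  : ∀ {v} → v ∈ members → v ≡ s ⊎ ∃ λ u → R u v

-- The set reachable from s: each member other than s has a predecessor among the members,
-- which by injectivity of R is its only one, so the set is also closed backwards.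
chain : ∀ {n} {R : Fin n → Fin n → Set} → Decidable₂ R →
  (∀ {u v w} → R u w → R v w → u ≡ v) →
  ∀ s → (∀ {u} → ¬ R u s) → Chain R s
chain {n} {R} R? R-injective s s-initial =
  grow ⁅ s ⁆ (⊃-wellFounded _) (x∈⁅x⁆ s) (inj₁ ∘ x∈⁅y⁆⇒x≡y s)
  where
  Reached : Subset n → Fin n → Set
  Reached O v = v ≡ s ⊎ ∃ λ u → u ∈ O × R u v

  grow : ∀ O → Acc _⊃_ O → s ∈ O → (∀ {v} → v ∈ O → Reached O v) → Chain R s
  grow O (acc larger) s∈O reached
    with any? (λ u → any? λ v → (u ∈? O) ×-dec R? u v ×-dec ¬? (v ∈? O))
  ... | yes (u , v , u∈O , Ruv , v∉O) =
    grow (O ∪ ⁅ v ⁆)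
      (larger (p⊆p∪q _ , v , q⊆p∪q O _ (x∈⁅x⁆ v) , v∉O))
      (p⊆p∪q _ s∈O)
      λ w∈ → [ weaken ∘ reached
             , (λ w∈⁅v⁆ → inj₂ (u , p⊆p∪q _ u∈O , subst (R u) (sym (x∈⁅y⁆⇒x≡y v w∈⁅v⁆)) Ruv))
             ]′ (x∈p∪q⁻ O _ w∈)
    where
    weaken : ∀ {w} → Reached O w → Reached (O ∪ ⁅ v ⁆) w
    weaken (inj₁ w≡s) = inj₁ w≡s
    weaken (inj₂ (u , u∈O , Ruw)) = inj₂ (u , p⊆p∪q _ u∈O , Ruw)
  ... | no saturated = record
    { members = O ; start = s∈O
    ; forward = forward ; backward = backward ; reached = forget ∘ reached }
    where
    forward : ∀ {u v} → R u v → u ∈ O → v ∈ O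
    forward {u} {v} Ruv u∈O with v ∈? O
    ... | yes v∈O = v∈O
    ... | no v∉O = ⊥-elim (saturated (u , v , u∈O , Ruv , v∉O))

    backward : ∀ {u v} → R u v → v ∈ O → u ∈ O
    backward Ruv v∈O with reached v∈O
    ... | inj₁ refl = ⊥-elim (s-initial Ruv)
    ... | inj₂ (u′ , u′∈O , Ru′v) = subst (_∈ O) (R-injective Ru′v Ruv) u′∈O

    forget : ∀ {v} → Reached O v → v ≡ s ⊎ ∃ λ u → R u v
    forget (inj₁ v≡s) = inj₁ v≡s
    forget (inj₂ (u , _ , Ruv)) = inj₂ (u , Ruv)

-- Kempe swaps and the insertion of one edge.

transpose-view : ∀ {n} (i j k : Fin n) →
  (k ≡ i × transpose i j k ≡ j) ⊎ (k ≡ j × transpose i j k ≡ i) ⊎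
  (k ≢ i × k ≢ j × transpose i j k ≡ k)
transpose-view i j k with k ≟ i
... | yes k≡i = inj₁ (k≡i , refl)
... | no k≢i with k ≟ j
...   | yes k≡j = inj₂ (inj₁ (k≡j , refl))
...   | no k≢j = inj₂ (inj₂ (k≢i , k≢j , refl))

transpose-injective : ∀ {n} (i j : Fin n) {k l} → transpose i j k ≡ transpose i j l → k ≡ l
transpose-injective i j eq =
  trans (sym (transpose-inverse j i)) (trans (cong (transpose j i) eq) (transpose-inverse j i))

-- A bipartite multigraph is given by the two ends x e and y e of each edge e.
-- The colour t is forbidden at the x-ends in P, the colour b at the y-ends in Q.
record Admissible {n m q} (x y : Fin m → Fin n) (P Q : Fin n → Set) (t b : Fin q)
                  (D : Fin m → Set) (r : Fin m → Fin q) : Set where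
  field
    x-proper : ∀ {f g} → D f → D g → x f ≡ x g → r f ≡ r g → f ≡ g
    y-proper : ∀ {f g} → D f → D g → y f ≡ y g → r f ≡ r g → f ≡ g
    x-avoids : ∀ {f} → D f → P (x f) → r f ≢ t
    y-avoids : ∀ {f} → D f → Q (y f) → r f ≢ b
open Admissible

module _ {n m q} {x y : Fin m → Fin n} {P Q : Fin n → Set} {t b : Fin q} where

  colourNewEdge : ∀ {D r} → Admissible x y P Q t b D r → ∀ e {c} →
    (∀ {f} → D f → x f ≡ x e → r f ≢ c) → (P (x e) → c ≢ t) →
    (∀ {f} → D f → y f ≡ y e → r f ≢ c) → (Q (y e) → c ≢ b) →
    ∃ (Admissible x y P Q t b (λ f → f ≡ e ⊎ D f))
  colourNewEdge {D} {r} adm e {c} x-free x-ok y-free y-ok = r′ , record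
    { x-proper = proper x (x-proper adm) x-free
    ; y-proper = proper y (y-proper adm) y-free
    ; x-avoids = avoids x P (x-avoids adm) x-ok
    ; y-avoids = avoids y Q (y-avoids adm) y-ok
    }
    where
    r′ : Fin m → Fin q
    r′ = updateAt r e (const c)

    new : r′ e ≡ c
    new = updateAt-updates e r

    old : ∀ {f} → f ≢ e → r′ f ≡ r f
    old {f} f≢e = updateAt-minimal f e r f≢e

    view : ∀ {f} → f ≡ e ⊎ D f → f ≡ e ⊎ (D f × r′ f ≡ r f)
    view (inj₁ f≡e) = inj₁ f≡e
    view {f} (inj₂ Df) with f ≟ e
    ... | yes f≡e = inj₁ f≡e
    ... | no f≢e = inj₂ (Df , old f≢e)

    proper : (z : Fin m → Fin n) →
      (∀ {f g} → D f → D g → z f ≡ z g → r f ≡ r g → f ≡ g) →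
      (∀ {f} → D f → z f ≡ z e → r f ≢ c) →
      ∀ {f g} → f ≡ e ⊎ D f → g ≡ e ⊎ D g → z f ≡ z g → r′ f ≡ r′ g → f ≡ g
    proper z inj free f∈ g∈ zf≡zg eq with view f∈ | view g∈
    ... | inj₁ refl | inj₁ refl = refl
    ... | inj₁ refl | inj₂ (Dg , g-old) =
      ⊥-elim (free Dg (sym zf≡zg) (trans (sym g-old) (trans (sym eq) new)))
    ... | inj₂ (Df , f-old) | inj₁ refl =
      ⊥-elim (free Df zf≡zg (trans (sym f-old) (trans eq new)))
    ... | inj₂ (Df , f-old) | inj₂ (Dg , g-old) =
      inj Df Dg zf≡zg (trans (sym f-old) (trans eq g-old))

    avoids : (z : Fin m → Fin n) (S : Fin n → Set) {a : Fin q} →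
      (∀ {f} → D f → S (z f) → r f ≢ a) → (S (z e) → c ≢ a) →
      ∀ {f} → f ≡ e ⊎ D f → S (z f) → r′ f ≢ a
    avoids z S old-ok new-ok f∈ Szf eq with view f∈
    ... | inj₁ refl = new-ok Szf (trans (sym new) eq)
    ... | inj₂ (Df , f-old) = old-ok Df Szf (trans (sym f-old) eq)

  extendByEdge : ∀ {D r} → Decidable D → Admissible x y P Q t b D r → ∀ e {α β} →
    α ≢ b → β ≢ t →
    (∀ {f} → D f → x f ≡ x e → r f ≢ α) → (P (x e) → α ≢ t) →
    (∀ {f} → D f → y f ≡ y e → r f ≢ β) → (Q (y e) → β ≢ b) →
    ∃ (Admissible x y P Q t b (λ f → f ≡ e ⊎ D f))
  extendByEdge {D} {r} D? adm e {α} {β} α≢b β≢t α-free α-ok β-free β-ok =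
    colourNewEdge swapped-adm e β-free-x (λ _ → β≢t) β-free-y β-ok
    where
    -- One double step β, α along the Kempe chain, between x-ends.
    R : Fin n → Fin n → Set
    R u v = ∃ λ f → ∃ λ g →
      (D f × x f ≡ u × r f ≡ β) × y f ≡ y g × (D g × x g ≡ v × r g ≡ α)

    R? : Decidable₂ R
    R? u v = any? λ f → any? λ g →
      (D? f ×-dec x f ≟ u ×-dec r f ≟ β) ×-dec y f ≟ y g ×-dec
      (D? g ×-dec x g ≟ v ×-dec r g ≟ α)

    R-injective : ∀ {u v w} → R u w → R v w → u ≡ v
    R-injective (f , g , (Df , xf , rf) , yfg , (Dg , xg , rg))
                (f′ , g′ , (Df′ , xf′ , rf′) , yfg′ , (Dg′ , xg′ , rg′)) =
      trans (sym xf) (trans (cong x f≡f′) xf′)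
      where
      g≡g′ : g ≡ g′
      g≡g′ = x-proper adm Dg Dg′ (trans xg (sym xg′)) (trans rg (sym rg′))
      f≡f′ : f ≡ f′
      f≡f′ = y-proper adm Df Df′ (trans yfg (trans (cong y g≡g′) (sym yfg′)))
               (trans rf (sym rf′))

    R-initial : ∀ {u} → ¬ R u (x e)
    R-initial (_ , _ , _ , _ , (Dg , xg , rg)) = α-free Dg xg rg

    open Chain (chain R? R-injective (x e) R-initial) renaming (members to O; start to e∈O)

    αβ-step : ∀ {f g} → D f → D g → y f ≡ y g → r f ≡ β → r g ≡ α → R (x f) (x g)
    αβ-step Df Dg yfg rf rg = _ , _ , (Df , refl , rf) , yfg , (Dg , refl , rg)

    -- An α-edge inside the chain is preceded by a β-edge at its y-end.
    predecessor : ∀ {g} → D g → x g ∈ O → r g ≡ α → ∃ λ f → D f × y f ≡ y g × r f ≡ β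
    predecessor {g} Dg xg∈O rg with reached xg∈O
    ... | inj₁ xg≡xe = ⊥-elim (α-free Dg xg≡xe rg)
    ... | inj₂ (u , f , g′ , (Df , _ , rf) , yfg′ , (Dg′ , xg′ , rg′)) =
      f , Df , trans yfg′ (cong y (x-proper adm Dg′ Dg xg′ (trans rg′ (sym rg)))) , rf

    τ : Fin q → Fin q
    τ = transpose α β

    swapIf : ∀ {v} → Dec (v ∈ O) → Fin q → Fin q
    swapIf (yes _) c = τ c
    swapIf (no _) c = c

    -- The x-end alone decides whether an edge is swapped. Edges with a common x-end are thus
    -- swapped together and stay distinct, so only y-ends need the closure of the chain.
    r′ : Fin m → Fin q
    r′ f = swapIf (x f ∈? O) (r f)

    view : ∀ f → (x f ∈ O × r′ f ≡ τ (r f)) ⊎ (x f ∉ O × r′ f ≡ r f)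
    view f with x f ∈? O
    ... | yes xf∈O = inj₁ (xf∈O , refl)
    ... | no xf∉O = inj₂ (xf∉O , refl)

    swapIf-injective : ∀ {v} (d : Dec (v ∈ O)) {c c′} → swapIf d c ≡ swapIf d c′ → c ≡ c′
    swapIf-injective (yes _) = transpose-injective α β
    swapIf-injective (no _) eq = eq

    x-proper′ : ∀ {f g} → D f → D g → x f ≡ x g → r′ f ≡ r′ g → f ≡ g
    x-proper′ {f} {g} Df Dg xf≡xg eq =
      x-proper adm Df Dg xf≡xg
        (swapIf-injective (x g ∈? O)
          (subst (λ v → swapIf (v ∈? O) (r f) ≡ r′ g) xf≡xg eq))

    -- A clash involving `α` or `β` would be a double step across the boundary of `O`, against its
    -- closure forwards or backwards. Any other colour is unchanged, so the old colouring would
    -- already identify the two edges.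
    y-proper-mixed : ∀ {f g} → D f → D g → y f ≡ y g → x f ∈ O → x g ∉ O → τ (r f) ≢ r g
    y-proper-mixed {f} Df Dg yfg xf∈O xg∉O eq with transpose-view α β (r f)
    ... | inj₁ (rf≡α , τ≡β) =
      xg∉O (backward (αβ-step Dg Df (sym yfg) (trans (sym eq) τ≡β) rf≡α) xf∈O)
    ... | inj₂ (inj₁ (rf≡β , τ≡α)) =
      xg∉O (forward (αβ-step Df Dg yfg rf≡β (trans (sym eq) τ≡α)) xf∈O)
    ... | inj₂ (inj₂ (_ , _ , τ≡)) =
      xg∉O (subst (λ h → x h ∈ O) (y-proper adm Df Dg yfg (trans (sym τ≡) eq)) xf∈O)

    y-proper′ : ∀ {f g} → D f → D g → y f ≡ y g → r′ f ≡ r′ g → f ≡ g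
    y-proper′ {f} {g} Df Dg yfg eq with view f | view g
    ... | inj₁ (_ , f-eq) | inj₁ (_ , g-eq) =
      y-proper adm Df Dg yfg
        (transpose-injective α β (trans (sym f-eq) (trans eq g-eq)))
    ... | inj₁ (f∈ , f-eq) | inj₂ (g∉ , g-eq) =
      ⊥-elim (y-proper-mixed Df Dg yfg f∈ g∉ (trans (sym f-eq) (trans eq g-eq)))
    ... | inj₂ (f∉ , f-eq) | inj₁ (g∈ , g-eq) =
      ⊥-elim (y-proper-mixed Dg Df (sym yfg) g∈ f∉ (trans (sym g-eq) (trans (sym eq) f-eq)))
    ... | inj₂ (_ , f-eq) | inj₂ (_ , g-eq) =
      y-proper adm Df Dg yfg (trans (sym f-eq) (trans eq g-eq))

    x-avoids′ : ∀ {f} → D f → P (x f) → r′ f ≢ t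
    x-avoids′ {f} Df Pxf eq with view f
    ... | inj₂ (_ , f-eq) = x-avoids adm Df Pxf (trans (sym f-eq) eq)
    ... | inj₁ (f∈ , f-eq) with transpose-view α β (r f)
    ...   | inj₁ (_ , τ≡β) = β≢t (trans (sym τ≡β) (trans (sym f-eq) eq))
    ...   | inj₂ (inj₂ (_ , _ , τ≡)) = x-avoids adm Df Pxf (trans (sym τ≡) (trans (sym f-eq) eq))
    -- An edge turning from `β` to `α` has its x-end either at `x e`, where `α-ok` applies, or at a
    -- vertex that already carried an `α`-edge; in both cases `α` is allowed there.
    ...   | inj₂ (inj₁ (_ , τ≡α)) with reached f∈ | trans (sym τ≡α) (trans (sym f-eq) eq)
    ...     | inj₁ xf≡xe | α≡t = α-ok (subst P xf≡xe Pxf) α≡t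
    ...     | inj₂ (_ , _ , g , _ , _ , (Dg , xg , rg)) | α≡t =
      x-avoids adm Dg (subst P (sym xg) Pxf) (trans rg α≡t)

    y-avoids′ : ∀ {f} → D f → Q (y f) → r′ f ≢ b
    y-avoids′ {f} Df Qyf eq with view f
    ... | inj₂ (_ , f-eq) = y-avoids adm Df Qyf (trans (sym f-eq) eq)
    ... | inj₁ (f∈ , f-eq) with transpose-view α β (r f)
    ...   | inj₂ (inj₁ (_ , τ≡α)) = α≢b (trans (sym τ≡α) (trans (sym f-eq) eq))
    ...   | inj₂ (inj₂ (_ , _ , τ≡)) = y-avoids adm Df Qyf (trans (sym τ≡) (trans (sym f-eq) eq))
    -- An edge turning from `α` to `β` shares its y-end with an old `β`-edge, so `β` was already
    -- allowed there.
    ...   | inj₁ (rf≡α , τ≡β) with predecessor Df f∈ rf≡α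
    ...     | g , Dg , ygf , rg≡β =
      y-avoids adm Dg (subst Q (sym ygf) Qyf)
        (trans rg≡β (trans (sym τ≡β) (trans (sym f-eq) eq)))

    swapped-adm : Admissible x y P Q t b D r′
    swapped-adm = record
      { x-proper = x-proper′ ; y-proper = y-proper′
      ; x-avoids = x-avoids′ ; y-avoids = y-avoids′ }

    τ≡β⇒≡α : ∀ {c} → τ c ≡ β → c ≡ α
    τ≡β⇒≡α {c} eq with transpose-view α β c
    ... | inj₁ (c≡α , _) = c≡α
    ... | inj₂ (inj₁ (c≡β , τ≡α)) = trans c≡β (trans (sym eq) τ≡α)
    ... | inj₂ (inj₂ (_ , c≢β , τ≡)) = ⊥-elim (c≢β (trans (sym τ≡) eq))

    β-free-x : ∀ {f} → D f → x f ≡ x e → r′ f ≢ β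
    β-free-x {f} Df xf≡xe eq with view f
    ... | inj₁ (_ , f-eq) = α-free Df xf≡xe (τ≡β⇒≡α (trans (sym f-eq) eq))
    ... | inj₂ (f∉ , _) = f∉ (subst (_∈ O) (sym xf≡xe) e∈O)

    β-free-y : ∀ {f} → D f → y f ≡ y e → r′ f ≢ β
    β-free-y {f} Df yf≡ye eq with view f
    ... | inj₂ (_ , f-eq) = β-free Df yf≡ye (trans (sym f-eq) eq)
    ... | inj₁ (f∈ , f-eq) with predecessor Df f∈ (τ≡β⇒≡α (trans (sym f-eq) eq))
    ...   | g , Dg , ygf , rg≡β = β-free Dg (trans ygf yf≡ye) rg≡β

-- Free colours from the degree bound, and ranks for all edges outside the matching.

DegreeAtMost : ∀ {n m} → ℕ → (Fin m → Fin n) → Set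
DegreeAtMost {n} {m} d z = ∀ v (h : Fin (suc d) → Fin m) →
  (∀ {i j} → h i ≡ h j → i ≡ j) → ¬ (∀ i → z (h i) ≡ v)

-- Pigeonhole: were every index used, one user for each together with `e` itself would be `suc d`
-- distinct edges at `z e`.
unusedIndex : ∀ {n m d} {z : Fin m → Fin n} → DegreeAtMost d z →
  ∀ e {B : Fin d → Fin m → Set} → Decidable₂ B →
  (∀ {i j f} → B i f → B j f → i ≡ j) →
  (∀ {i f} → B i f → f ≢ e × z f ≡ z e) →
  ∃ λ i → ∀ {f} → ¬ B i f
unusedIndex {m = m} {d} {z} deg≤d e {B} B? unique adjacent
  with any? (λ i → ¬? (any? (B? i)))
... | yes (i , unused) = i , λ Bif → unused (_ , Bif)
... | no ¬unused = ⊥-elim (deg≤d (z e) h h-injective at-ze)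
  where
  user : ∀ i → ∃ (B i)
  user i = decidable-stable (any? (B? i)) (λ unused → ¬unused (i , unused))

  h : Fin (suc d) → Fin m
  h zero = e
  h (suc i) = proj₁ (user i)

  h-injective : ∀ {i j} → h i ≡ h j → i ≡ j
  h-injective {zero} {zero} _ = refl
  h-injective {zero} {suc j} eq = ⊥-elim (proj₁ (adjacent (proj₂ (user j))) (sym eq))
  h-injective {suc i} {zero} eq = ⊥-elim (proj₁ (adjacent (proj₂ (user i))) eq)
  h-injective {suc i} {suc j} eq =
    cong suc (unique (subst (B i) eq (proj₂ (user i))) (proj₂ (user j)))

  at-ze : ∀ i → z (h i) ≡ z e
  at-ze zero = refl
  at-ze (suc i) = proj₂ (adjacent (proj₂ (user i)))

Covered : ∀ {n m} → (Fin m → Set) → (Fin m → Fin n) → Fin n → Set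
Covered M z v = ∃ λ f → M f × z f ≡ v

-- Each edge other than `e` at `z e` rules out at most one of the `d` candidates `κ i`: an edge of
-- `D` its own colour, an edge of `M` the forbidden colour `t`. Since `D` and `M` are disjoint, no
-- edge does both.
freeColour : ∀ {n m d q} {z : Fin m → Fin n} → DegreeAtMost d z →
  ∀ {M D : Fin m → Set} → Decidable M → Decidable D → (∀ {f} → D f → ¬ M f) →
  ∀ (r : Fin m → Fin q) {κ : Fin d → Fin q} → (∀ {i j} → κ i ≡ κ j → i ≡ j) → ∀ t e →
  ¬ D e → ¬ M e →
  ∃ λ i → (∀ {f} → D f → z f ≡ z e → r f ≢ κ i) × (Covered M z (z e) → κ i ≢ t)
freeColour {z = z} deg≤d {M} {D} M? D? disjoint r {κ} κ-injective t e ¬De ¬Me =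
  i , (λ Df zf≡ze rf≡ → unused ((λ { refl → ¬De Df }) , zf≡ze , inj₁ (Df , rf≡)))
    , (λ { (f , Mf , zf≡ze) κi≡t → unused ((λ { refl → ¬Me Mf }) , zf≡ze , inj₂ (Mf , κi≡t)) })
  where
  Uses : _ → _ → Set
  Uses i f = f ≢ e × z f ≡ z e × (D f × r f ≡ κ i ⊎ M f × κ i ≡ t)

  Uses? : Decidable₂ Uses
  Uses? i f = ¬? (f ≟ e) ×-dec z f ≟ z e ×-dec
    (D? f ×-dec r f ≟ κ i ⊎-dec M? f ×-dec κ i ≟ t)

  unique : ∀ {i j f} → Uses i f → Uses j f → i ≡ j
  unique (_ , _ , inj₁ (_ , p)) (_ , _ , inj₁ (_ , q)) = κ-injective (trans (sym p) q)
  unique (_ , _ , inj₁ (Df , _)) (_ , _ , inj₂ (Mf , _)) = ⊥-elim (disjoint Df Mf)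
  unique (_ , _ , inj₂ (Mf , _)) (_ , _ , inj₁ (Df , _)) = ⊥-elim (disjoint Df Mf)
  unique (_ , _ , inj₂ (_ , p)) (_ , _ , inj₂ (_ , q)) = κ-injective (trans p (sym q))

  unusedPair : ∃ λ i → ∀ {f} → ¬ Uses i f
  unusedPair = unusedIndex deg≤d e Uses? unique (λ (f≢e , zf≡ze , _) → f≢e , zf≡ze)

  i = proj₁ unusedPair
  unused : ∀ {f} → ¬ Uses i f
  unused = proj₂ unusedPair

module _ {n m q} {x y : Fin m → Fin n} {P Q : Fin n → Set} {t b : Fin q} where

  restrict : ∀ {D D′ : Fin m → Set} → (∀ {f} → D′ f → D f) →
    ∃ (Admissible x y P Q t b D) → ∃ (Admissible x y P Q t b D′)
  restrict D′⊆D (r , adm) = r , record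
    { x-proper = λ Df Dg → x-proper adm (D′⊆D Df) (D′⊆D Dg)
    ; y-proper = λ Df Dg → y-proper adm (D′⊆D Df) (D′⊆D Dg)
    ; x-avoids = x-avoids adm ∘ D′⊆D
    ; y-avoids = y-avoids adm ∘ D′⊆D
    }

admissibleColouring : ∀ {n m Δ} {x y : Fin m → Fin n} →
  DegreeAtMost Δ x → DegreeAtMost Δ y → ∀ {M : Fin m → Set} → Decidable M →
  ∃ (Admissible x y (Covered M x) (Covered M y) (fromℕ Δ) zero (λ f → ¬ M f))
admissibleColouring {n} {m} {Δ} {x} {y} x-deg y-deg {M} M? =
  restrict (λ ¬Mf → ∈-allFin _ , ¬Mf) (colour (allFin m))
  where
  Listed : List (Fin m) → Fin m → Set
  Listed es f = f ∈ˡ es × ¬ M f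

  Listed? : ∀ es → Decidable (Listed es)
  Listed? es f = anyˡ? (f ≟_) es ×-dec ¬? (M? f)

  colour : ∀ es → ∃ (Admissible x y (Covered M x) (Covered M y) (fromℕ Δ) zero (Listed es))
  colour [] = const zero , record
    { x-proper = λ () ; y-proper = λ () ; x-avoids = λ () ; y-avoids = λ () }
  colour (e ∷ es) with colour es | M? e | Listed? es e
  ... | coloured | yes Me | _ =
    restrict (λ { (here refl , ¬Me) → ⊥-elim (¬Me Me) ; (there f∈ , ¬Mf) → f∈ , ¬Mf }) coloured
  ... | coloured | no _ | yes listed =
    restrict (λ { (here refl , _) → listed ; (there f∈ , ¬Mf) → f∈ , ¬Mf }) coloured
  ... | r , adm | no ¬Me | no unlisted
    -- Both ends offer exactly `Δ` candidates: `suc` leaves out `zero`, which gives `α ≢ b`, and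
    -- `inject₁` leaves out `fromℕ Δ`, which gives `β ≢ t`.
    with freeColour x-deg M? (Listed? es) proj₂ r suc-injective (fromℕ Δ) e unlisted ¬Me
       | freeColour y-deg M? (Listed? es) proj₂ r inject₁-injective zero e unlisted ¬Me
  ... | i , α-free , α-ok | j , β-free , β-ok =
    restrict (λ { (here refl , _) → inj₁ refl ; (there f∈ , ¬Mf) → inj₂ (f∈ , ¬Mf) })
      (extendByEdge (Listed? es) adm e (0≢1+n ∘ sym) (fromℕ≢inject₁ ∘ sym)
        α-free α-ok β-free β-ok)

-- Kernels of the preference digraph.

-- Edges at a common x-end are ranked by a, larger being preferred;
-- edges at a common y-end are ranked by b, smaller being preferred.
module Galvin {n m k} (x y : Fin m → Fin n) (a b : Fin m → Fin k)
  (a-injective : ∀ {e f} → x e ≡ x f → a e ≡ a f → e ≡ f)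
  (b-injective : ∀ {e f} → y e ≡ y f → b e ≡ b f → e ≡ f) where

  x-Beats y-Beats : Fin m → Fin m → Set
  x-Beats e f = x f ≡ x e × a e < a f
  y-Beats e f = y f ≡ y e × b f < b e

  x-Beats? : Decidable₂ x-Beats
  x-Beats? e f = x f ≟ x e ×-dec a e <? a f

  y-Beats? : Decidable₂ y-Beats
  y-Beats? e f = y f ≟ y e ×-dec b f <? b e

  y-Beats-trans : ∀ {e f g} → y-Beats e f → y-Beats f g → y-Beats e g
  y-Beats-trans (yf≡ye , bf<be) (yg≡yf , bg<bf) = trans yg≡yf yf≡ye , <-trans bg<bf bf<be

  x-compare : ∀ {e f} → x e ≡ x f → e ≢ f → x-Beats e f ⊎ x-Beats f e
  x-compare {e} {f} xe≡xf e≢f with <-cmp (a e) (a f)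
  ... | tri< ae<af _ _ = inj₁ (sym xe≡xf , ae<af)
  ... | tri≈ _ ae≡af _ = ⊥-elim (e≢f (a-injective xe≡xf ae≡af))
  ... | tri> _ _ af<ae = inj₂ (xe≡xf , af<ae)

  y-compare : ∀ {e f} → y e ≡ y f → e ≢ f → y-Beats e f ⊎ y-Beats f e
  y-compare {e} {f} ye≡yf e≢f with <-cmp (b e) (b f)
  ... | tri< be<bf _ _ = inj₂ (ye≡yf , be<bf)
  ... | tri≈ _ be≡bf _ = ⊥-elim (e≢f (b-injective ye≡yf be≡bf))
  ... | tri> _ _ bf<be = inj₁ (sym ye≡yf , bf<be)

  Meets : Fin m → Fin m → Set
  Meets e f = x e ≡ x f ⊎ y e ≡ y f

  -- This is a kernel, in the usual sense, of the digraph on `T` with an arc from each edge to every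
  -- neighbour that beats it.
  record Kernel (T : Subset m) : Set where
    field
      members     : Subset m
      members⊆    : members ⊆ T
      independent : ∀ {e f} → e ∈ members → f ∈ members → Meets e f → e ≡ f
      absorbing   : ∀ {e} → e ∈ T → e ∉ members →
                    ∃ λ f → f ∈ members × (x-Beats e f ⊎ y-Beats e f)

  x-Best : Subset m → Fin m → Set
  x-Best T e = e ∈ T × ¬ ∃ λ f → f ∈ T × x-Beats e f

  x-Best? : ∀ T → Decidable (x-Best T)
  x-Best? T e = e ∈? T ×-dec ¬? (any? λ f → f ∈? T ×-dec x-Beats? e f)

  -- If `f` is itself beaten, climb to what beats it; `a` strictly increases within a finite order,
  -- so the climb ends.
  beatenByBest : ∀ {T e} → Acc _>_ (a e) → ∀ {f} → f ∈ T → x-Beats e f →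
    ∃ λ g → x-Best T g × x-Beats e g
  beatenByBest {T} (acc larger) {f} f∈T (xf≡xe , ae<af)
    with any? (λ g → g ∈? T ×-dec x-Beats? f g)
  ... | no unbeaten = f , (f∈T , unbeaten) , xf≡xe , ae<af
  ... | yes (g , g∈T , beats) with beatenByBest (larger ae<af) g∈T beats
  ...   | h , best , xh≡xf , af<ah = h , best , trans xh≡xf xf≡xe , <-trans ae<af af<ah

  -- If an x-best edge e beats f at y, then f can be discarded: whatever absorbs e
  -- does so at y, hence also absorbs f. Otherwise the x-best edges form a kernel.
  kernel : ∀ T → Acc _⊂_ T → Kernel T
  kernel T (acc smaller)
    with any? (λ e → any? λ f → x-Best? T e ×-dec f ∈? T ×-dec y-Beats? f e)
  ... | yes (e , f , (e∈T , unbeaten) , f∈T , e-beats-f) = record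
    { members = I ; members⊆ = p─q⊆p T ⁅ f ⁆ ∘ I⊆ ; independent = indep ; absorbing = absorbing }
    where
    open Kernel (kernel (T - f) (smaller (x∈p⇒p-x⊂p f∈T)))
      renaming (members to I; members⊆ to I⊆; independent to indep; absorbing to absorb)

    e≢f : e ≢ f
    e≢f refl = <-irrefl refl (proj₂ e-beats-f)

    absorb-f : ∃ λ g → g ∈ I × (x-Beats f g ⊎ y-Beats f g)
    absorb-f with e ∈? I
    ... | yes e∈I = e , e∈I , inj₂ e-beats-f
    ... | no e∉I with absorb (x∈p∧x≢y⇒x∈p-y e∈T e≢f) e∉I
    ...   | g , g∈I , inj₁ beats = ⊥-elim (unbeaten (g , p─q⊆p T ⁅ f ⁆ (I⊆ g∈I) , beats))
    ...   | g , g∈I , inj₂ beats = g , g∈I , inj₂ (y-Beats-trans e-beats-f beats)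

    absorbing : ∀ {g} → g ∈ T → g ∉ I → ∃ λ h → h ∈ I × (x-Beats g h ⊎ y-Beats g h)
    absorbing {g} g∈T g∉I with g ≟ f
    ... | yes refl = absorb-f
    ... | no g≢f = absorb (x∈p∧x≢y⇒x∈p-y g∈T g≢f) g∉I
  ... | no unbeatenAtY = record
    { members = subset (x-Best? T) ; members⊆ = proj₁ ∘ best
    ; independent = λ e∈ f∈ → indep (best e∈) (best f∈) ; absorbing = absorbing }
    where
    best : ∀ {e} → e ∈ subset (x-Best? T) → x-Best T e
    best = ∈-subset⁻ (x-Best? T)

    indep : ∀ {e f} → x-Best T e → x-Best T f → Meets e f → e ≡ f
    indep {e} {f} e-best f-best meets with e ≟ f
    ... | yes e≡f = e≡f
    indep {e} {f} e-best f-best (inj₁ xe≡xf) | no e≢f with x-compare xe≡xf e≢f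
    ... | inj₁ beats = ⊥-elim (proj₂ e-best (f , proj₁ f-best , beats))
    ... | inj₂ beats = ⊥-elim (proj₂ f-best (e , proj₁ e-best , beats))
    indep {e} {f} e-best f-best (inj₂ ye≡yf) | no e≢f with y-compare ye≡yf e≢f
    ... | inj₁ beats = ⊥-elim (unbeatenAtY (f , e , f-best , proj₁ e-best , beats))
    ... | inj₂ beats = ⊥-elim (unbeatenAtY (e , f , e-best , proj₁ f-best , beats))

    absorbing : ∀ {e} → e ∈ T → e ∉ subset (x-Best? T) →
      ∃ λ f → f ∈ subset (x-Best? T) × (x-Beats e f ⊎ y-Beats e f)
    absorbing {e} e∈T e∉ with any? (λ f → f ∈? T ×-dec x-Beats? e f)
    ... | no unbeaten = ⊥-elim (e∉ (∈-subset⁺ (x-Best? T) (e∈T , unbeaten)))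
    ... | yes (f , f∈T , beats) with beatenByBest (>-wellFounded (a e)) f∈T beats
    ...   | g , g-best , beats′ = g , ∈-subset⁺ (x-Best? T) g-best , inj₁ beats′

  -- Counting better neighbours, and list colouring from kernels.

  x-Better y-Better : Subset m → Fin m → Subset m
  x-Better S e = subset (λ f → f ∈? S ×-dec x-Beats? e f)
  y-Better S e = subset (λ f → f ∈? S ×-dec y-Beats? e f)

  x-Better⁻ : ∀ S e {f} → f ∈ x-Better S e → f ∈ S × x-Beats e f
  x-Better⁻ S e = ∈-subset⁻ (λ f → f ∈? S ×-dec x-Beats? e f)

  y-Better⁻ : ∀ S e {f} → f ∈ y-Better S e → f ∈ S × y-Beats e f
  y-Better⁻ S e = ∈-subset⁻ (λ f → f ∈? S ×-dec y-Beats? e f)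

  x-Better⁺ : ∀ S e {f} → f ∈ S × x-Beats e f → f ∈ x-Better S e
  x-Better⁺ S e = ∈-subset⁺ (λ f → f ∈? S ×-dec x-Beats? e f)

  y-Better⁺ : ∀ S e {f} → f ∈ S × y-Beats e f → f ∈ y-Better S e
  y-Better⁺ S e = ∈-subset⁺ (λ f → f ∈? S ×-dec y-Beats? e f)

  module _ {S S′ : Subset m} (S⊆S′ : S ⊆ S′) (e : Fin m) where

    x-Better-mono : x-Better S e ⊆ x-Better S′ e
    x-Better-mono f∈ with x-Better⁻ S e f∈
    ... | f∈S , beats = x-Better⁺ S′ e (S⊆S′ f∈S , beats)

    y-Better-mono : y-Better S e ⊆ y-Better S′ e
    y-Better-mono f∈ with y-Better⁻ S e f∈
    ... | f∈S , beats = y-Better⁺ S′ e (S⊆S′ f∈S , beats)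

    -- Removing a kernel costs each absorbed edge a better neighbour, which pays for the colour
    -- struck from its list.
    Better-shrinks : ∀ {f} → f ∈ S′ → f ∉ S → x-Beats e f ⊎ y-Beats e f →
      ∣ x-Better S e ∣ ℕ.+ ∣ y-Better S e ∣ ℕ.< ∣ x-Better S′ e ∣ ℕ.+ ∣ y-Better S′ e ∣
    Better-shrinks f∈S′ f∉S (inj₁ beats) = ℕ.+-mono-<-≤
      (p⊂q⇒∣p∣<∣q∣ (x-Better-mono , _ , x-Better⁺ S′ e (f∈S′ , beats) , f∉S ∘ proj₁ ∘ x-Better⁻ S e))
      (p⊆q⇒∣p∣≤∣q∣ y-Better-mono)
    Better-shrinks f∈S′ f∉S (inj₂ beats) = ℕ.+-mono-≤-<
      (p⊆q⇒∣p∣≤∣q∣ x-Better-mono)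
      (p⊂q⇒∣p∣<∣q∣ (y-Better-mono , _ , y-Better⁺ S′ e (f∈S′ , beats) , f∉S ∘ proj₁ ∘ y-Better⁻ S e))

  unbeaten⇒Better-empty : ∀ S {e} → (∀ {f} → ¬ x-Beats e f) → (∀ {f} → ¬ y-Beats e f) →
    ∣ x-Better S e ∣ ℕ.+ ∣ y-Better S e ∣ ℕ.≤ 0
  unbeaten⇒Better-empty S {e} x-unbeaten y-unbeaten = ℕ.+-mono-≤
    (empty (x-Better S e) (x-unbeaten ∘ proj₂ ∘ x-Better⁻ S e))
    (empty (y-Better S e) (y-unbeaten ∘ proj₂ ∘ y-Better⁻ S e))
    where
    empty : ∀ p → (∀ {f} → f ∉ p) → ∣ p ∣ ℕ.≤ 0
    empty p ∉p = ℕ.≤-trans (p⊆q⇒∣p∣≤∣q∣ {q = ⊥} (λ f∈p → ⊥-elim (∉p f∈p))) (ℕ.≤-reflexive (∣⊥∣≡0 m))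

  -- Better edges at the x-end have distinct ranks above `a e`, those at the y-end distinct ranks
  -- below it; together these ranks are at most `k - 1`.
  balanced⇒Better-small : ∀ S {e} → a e ≡ b e →
    ∣ x-Better S e ∣ ℕ.+ ∣ y-Better S e ∣ ℕ.< k
  balanced⇒Better-small S {e} ae≡be = ℕ.≤-<-trans
    (ℕ.+-mono-≤
      (injection⇒∣p∣≤∣q∣ a (x-Better S e) (subset (λ j → a e <? j))
        (∈-subset⁺ (λ j → a e <? j) ∘ proj₂ ∘ above)
        (λ f∈ g∈ → a-injective (trans (proj₁ (above f∈)) (sym (proj₁ (above g∈))))))
      (injection⇒∣p∣≤∣q∣ b (y-Better S e) (subset (λ j → j <? a e))
        (∈-subset⁺ (λ j → j <? a e) ∘ subst (_ <_) (sym ae≡be) ∘ proj₂ ∘ below)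
        (λ f∈ g∈ → b-injective (trans (proj₁ (below f∈)) (sym (proj₁ (below g∈)))))))
    (∣above∣+∣below∣<n (a e))
    where
    above : ∀ {f} → f ∈ x-Better S e → x-Beats e f
    above = proj₂ ∘ x-Better⁻ S e
    below : ∀ {f} → f ∈ y-Better S e → y-Beats e f
    below = proj₂ ∘ y-Better⁻ S e

  record ListColouring {q} (S : Subset m) (L : Fin m → Subset q) : Set where
    field
      -- The colour depends on a membership proof because an empty palette has no default for edges
      -- outside `S`.
      colour : ∀ {e} → e ∈ S → Fin q
      listed : ∀ {e} (e∈S : e ∈ S) → colour e∈S ∈ L e
      proper : ∀ {e f} (e∈S : e ∈ S) (f∈S : f ∈ S) → Meets e f →
               colour e∈S ≡ colour f∈S → e ≡ f

  -- Induction on the palette. Colour `zero` goes to a kernel of the edges listing it. Any other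
  -- edge listing `zero` is absorbed, so it loses a better neighbour along with the colour; an edge
  -- not listing it keeps its whole list.
  listColour : ∀ {q} S (L : Fin m → Subset q) →
    (∀ {e} → e ∈ S → ∣ x-Better S e ∣ ℕ.+ ∣ y-Better S e ∣ ℕ.< ∣ L e ∣) → ListColouring S L
  listColour {ℕ.zero} S L out<∣L∣ = record
    { colour = ⊥-elim ∘ absurd
    ; listed = ⊥-elim ∘ absurd
    ; proper = λ e∈S → ⊥-elim (absurd e∈S) }
    where
    absurd : ∀ {e} → ¬ e ∈ S
    absurd {e} e∈S with L e | out<∣L∣ e∈S
    ... | [] | ()
  listColour {suc q} S L out<∣L∣ = record
    { colour = λ e∈S → colour (split e∈S)
    ; listed = λ e∈S → listed (split e∈S)
    ; proper = λ e∈S f∈S → proper (split e∈S) (split f∈S) }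
    where
    T : Subset m
    T = S ∩ subset (λ e → zero ∈? L e)

    open Kernel (kernel T (⊂-wellFounded T)) renaming (members to I; members⊆ to I⊆)

    S′ : Subset m
    S′ = subset (λ e → e ∈? S ×-dec ¬? (e ∈? I))

    S′⁻ : ∀ {e} → e ∈ S′ → e ∈ S × e ∉ I
    S′⁻ = ∈-subset⁻ (λ e → e ∈? S ×-dec ¬? (e ∈? I))

    I⊆S : I ⊆ S
    I⊆S = proj₁ ∘ x∈p∩q⁻ S _ ∘ I⊆

    zero-listed : ∀ {e} → e ∈ I → zero ∈ L e
    zero-listed = ∈-subset⁻ (λ e → zero ∈? L e) ∘ proj₂ ∘ x∈p∩q⁻ S _ ∘ I⊆

    S′⊆S : S′ ⊆ S
    S′⊆S = proj₁ ∘ S′⁻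

    L′ : Fin m → Subset q
    L′ e = tail (L e)

    out<∣L′∣ : ∀ {e} → e ∈ S′ → ∣ x-Better S′ e ∣ ℕ.+ ∣ y-Better S′ e ∣ ℕ.< ∣ L′ e ∣
    out<∣L′∣ {e} e∈S′ with zero ∈? L e
    ... | no 0∉L = ℕ.≤-<-trans
      (ℕ.+-mono-≤ (p⊆q⇒∣p∣≤∣q∣ (x-Better-mono S′⊆S e)) (p⊆q⇒∣p∣≤∣q∣ (y-Better-mono S′⊆S e)))
      (subst (_ ℕ.<_) (∣p∣≡∣tail∣ (L e) 0∉L) (out<∣L∣ (S′⊆S e∈S′)))
    ... | yes 0∈L
      with absorbing (x∈p∩q⁺ (S′⊆S e∈S′ , ∈-subset⁺ (λ e → zero ∈? L e) 0∈L)) (proj₂ (S′⁻ e∈S′))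
    ...   | f , f∈I , beats = ℕ.<-≤-trans
      (Better-shrinks S′⊆S e (I⊆S f∈I) (λ f∈S′ → proj₂ (S′⁻ f∈S′) f∈I) beats)
      (ℕ.s≤s⁻¹ (ℕ.≤-trans (out<∣L∣ (S′⊆S e∈S′)) (∣p∣≤1+∣tail∣ (L e))))

    open ListColouring (listColour S′ L′ out<∣L′∣)
      renaming (colour to colour′; listed to listed′; proper to proper′)

    Part : Fin m → Set
    Part e = e ∈ I ⊎ e ∈ S′

    split : ∀ {e} → e ∈ S → Part e
    split {e} e∈S with e ∈? I
    ... | yes e∈I = inj₁ e∈I
    ... | no e∉I = inj₂ (∈-subset⁺ (λ e → e ∈? S ×-dec ¬? (e ∈? I)) (e∈S , e∉I))

    colour : ∀ {e} → Part e → Fin (suc q)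
    colour (inj₁ _) = zero
    colour (inj₂ e∈S′) = suc (colour′ e∈S′)

    listed : ∀ {e} (e∈ : Part e) → colour e∈ ∈ L e
    listed (inj₁ e∈I) = zero-listed e∈I
    listed {e} (inj₂ e∈S′) with L e | listed′ e∈S′
    ... | _ ∷ _ | ∈tail = there ∈tail

    proper : ∀ {e f} (e∈ : Part e) (f∈ : Part f) → Meets e f → colour e∈ ≡ colour f∈ → e ≡ f
    proper (inj₁ e∈I) (inj₁ f∈I) meets _ = independent e∈I f∈I meets
    proper (inj₂ e∈S′) (inj₂ f∈S′) meets eq = proper′ e∈S′ f∈S′ meets (suc-injective eq)

-- Ranks and lists determined by the precolouring.

Precoloured : ∀ {m} {C : Set} → (Fin m → Maybe C) → Fin m → Set
Precoloured pre e = ∃ λ c → pre e ≡ just c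

precoloured? : ∀ {m} {C : Set} (pre : Fin m → Maybe C) → Decidable (Precoloured pre)
precoloured? pre e with pre e
... | just c = yes (c , refl)
... | nothing = no λ ()

module _ {n m Δ} (x y : Fin m → Fin n) (pre : Fin m → Maybe (Fin (suc Δ)))
  (matching : ∀ {e f c d} → pre e ≡ just c → pre f ≡ just d → x e ≡ x f ⊎ y e ≡ y f → e ≡ f)
  {r : Fin m → Fin (suc Δ)}
  (admissible : Admissible x y (Covered (Precoloured pre) x) (Covered (Precoloured pre) y)
                  (fromℕ Δ) zero (λ e → ¬ Precoloured pre e) r)
  where

  rank : Fin (suc Δ) → Fin m → Fin (suc Δ)
  rank t e = maybe′ (const t) (r e) (pre e)

  rank-precoloured : ∀ {t e c} → pre e ≡ just c → rank t e ≡ t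
  rank-precoloured = cong (maybe′ _ _)

  rank-uncoloured : ∀ {t e} → pre e ≡ nothing → rank t e ≡ r e
  rank-uncoloured = cong (maybe′ _ _)

  ¬precoloured : ∀ {e} → pre e ≡ nothing → ¬ Precoloured pre e
  ¬precoloured eq (_ , eq′) with trans (sym eq) eq′
  ... | ()

  -- Two precoloured edges are separated by the matching property, two others by `r`. A mixed tie
  -- would put rank `t` on an edge at a covered vertex, which `avoids` excludes.
  rank-injective : ∀ (z : Fin m → Fin n) t →
    (∀ {e f c d} → pre e ≡ just c → pre f ≡ just d → z e ≡ z f → e ≡ f) →
    (∀ {e f} → ¬ Precoloured pre e → ¬ Precoloured pre f → z e ≡ z f → r e ≡ r f → e ≡ f) →
    (∀ {e} → ¬ Precoloured pre e → Covered (Precoloured pre) z (z e) → r e ≢ t) →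
    ∀ {e f} → z e ≡ z f → rank t e ≡ rank t f → e ≡ f
  rank-injective z t match proper avoids {e} {f} ze≡zf eq with pre e in pe | pre f in pf
  ... | just _ | just _ = match pe pf ze≡zf
  ... | nothing | nothing = proper (¬precoloured pe) (¬precoloured pf) ze≡zf eq
  ... | just c | nothing = ⊥-elim (avoids (¬precoloured pf) (e , (c , pe) , ze≡zf) (sym eq))
  ... | nothing | just d = ⊥-elim (avoids (¬precoloured pe) (f , (d , pf) , sym ze≡zf) eq)

  a b : Fin m → Fin (suc Δ)
  a = rank (fromℕ Δ)
  b = rank zero

  a-injective : ∀ {e f} → x e ≡ x f → a e ≡ a f → e ≡ f
  a-injective = rank-injective x (fromℕ Δ) (λ pe pf → matching pe pf ∘ inj₁)
    (x-proper admissible) (x-avoids admissible)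

  b-injective : ∀ {e f} → y e ≡ y f → b e ≡ b f → e ≡ f
  b-injective = rank-injective y zero (λ pe pf → matching pe pf ∘ inj₂)
    (y-proper admissible) (y-avoids admissible)

  open Galvin x y a b a-injective b-injective

  lists : Fin m → Subset (suc Δ)
  lists e = maybe′ ⁅_⁆ ⊤ (pre e)

  Better<lists : ∀ e → ∣ x-Better ⊤ e ∣ ℕ.+ ∣ y-Better ⊤ e ∣ ℕ.< ∣ lists e ∣
  Better<lists e = bound (pre e) refl
    where
    bound : ∀ p → pre e ≡ p → ∣ x-Better ⊤ e ∣ ℕ.+ ∣ y-Better ⊤ e ∣ ℕ.< ∣ maybe′ ⁅_⁆ ⊤ p ∣
    -- Here `a e` is the greatest rank and `b e` the least, so nothing beats `e` and a one-element
    -- list suffices.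
    bound (just c) pe = ℕ.≤-trans
      (ℕ.s≤s (unbeaten⇒Better-empty ⊤
        (λ (_ , ae<af) → ℕ.<⇒≱ ae<af (subst (_ ≤_) (sym (rank-precoloured pe)) (≤fromℕ _)))
        (λ (_ , bf<be) → ℕ.n≮0 (subst (_ <_) (rank-precoloured pe) bf<be))))
      (ℕ.≤-reflexive (sym (∣⁅x⁆∣≡1 c)))
    -- Here `a e` and `b e` are both `r e`, as the balanced count requires.
    bound nothing pe = ℕ.<-≤-trans
      (balanced⇒Better-small ⊤
        (trans (rank-uncoloured pe) (sym (rank-uncoloured pe))))
      (ℕ.≤-reflexive (sym (∣⊤∣≡n (suc Δ))))

  extendMatching : ∃ λ (c : Fin m → Fin (suc Δ)) →
    (∀ {e f} → x e ≡ x f ⊎ y e ≡ y f → c e ≡ c f → e ≡ f) × Extends c pre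
  extendMatching = c , proper ∈⊤ ∈⊤ , extends
    where
    open ListColouring (listColour ⊤ lists (λ {e} _ → Better<lists e))

    c : Fin m → Fin (suc Δ)
    c e = colour (∈⊤ {x = e})

    extends : Extends c pre
    extends e {d} pe = x∈⁅y⁆⇒x≡y d
      (subst (λ p → c e ∈ maybe′ ⁅_⁆ ⊤ p) pe (listed ∈⊤))

-- From bipartite multigraphs to pairs of end maps.

≤-foldr-⊔ : ∀ {k ks} → k ∈ˡ ks → k ℕ.≤ foldr ℕ._⊔_ 0 ks
≤-foldr-⊔ {k} {_ ∷ ks} (here refl) = ℕ.m≤m⊔n k _
≤-foldr-⊔ {k} {k′ ∷ ks} (there k∈) = ℕ.≤-trans (≤-foldr-⊔ k∈) (ℕ.m≤n⊔m k′ _)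

module _ {n m} (G : Multigraph n m) where

  degree≤maxDegree : ∀ v → degree G v ℕ.≤ maxDegree G
  degree≤maxDegree v = ≤-foldr-⊔ (∈-map⁺ (degree G) (∈-allFin v))

  incident : ∀ {v e} → v isEndOf e within G → Bool.T (incident? G v e)
  incident {v} {e} end with v ≟ proj₁ (ends G e) | v ≟ proj₂ (ends G e)
  ... | yes _ | _ = tt
  ... | no _ | yes _ = tt
  incident (inj₁ v≡) | no v≢ | no _ = v≢ v≡
  incident (inj₂ v≡) | no _ | no v≢ = v≢ v≡

  -- The degree is the length of a list, so it bounds the number of distinct positions which the
  -- edges `h i` occupy in that list.
  injection⇒≤degree : ∀ {k v} (h : Fin k → Fin m) → (∀ {i j} → h i ≡ h j → i ≡ j) →
    (∀ i → v isEndOf h i within G) → k ℕ.≤ degree G v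
  injection⇒≤degree {k} {v} h h-injective end =
    injective⇒≤ {f = index ∘ listed} λ {i} {j} eq →
      h-injective (trans (lookup-index (listed i))
        (trans (cong (lookup incidentEdges) eq) (sym (lookup-index (listed j)))))
    where
    incidentEdges = filter (λ e → Bool.T? (incident? G v e)) (allFin m)

    listed : ∀ i → h i ∈ˡ incidentEdges
    listed i = ∈-filter⁺ (λ e → Bool.T? (incident? G v e)) (∈-allFin (h i)) (incident (end i))

  module _ (sides : Bipartite G) where

    private
      side : Fin n → Bool
      side = proj₁ sides

    -- Testing the first end is enough: if it is not on side `s`, bipartiteness puts the second end
    -- there.
    endOn : Bool → Fin m → Fin n
    endOn s e =
      if does (side (proj₁ (ends G e)) Bool.≟ s) then proj₁ (ends G e) else proj₂ (ends G e)

    endOn-isEnd : ∀ s e → endOn s e isEndOf e within G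
    endOn-isEnd s e with does (side (proj₁ (ends G e)) Bool.≟ s)
    ... | true = inj₁ refl
    ... | false = inj₂ refl

    endOn-unique : ∀ {v e} → v isEndOf e within G → endOn (side v) e ≡ v
    endOn-unique {v} {e} end with side (proj₁ (ends G e)) Bool.≟ side v
    endOn-unique (inj₁ v≡) | yes _ = sym v≡
    endOn-unique {e = e} (inj₂ refl) | yes same = ⊥-elim (not-¬ same (proj₂ sides e))
    endOn-unique (inj₁ refl) | no differ = ⊥-elim (differ refl)
    endOn-unique (inj₂ v≡) | no _ = sym v≡

    endOn-degree : ∀ s → DegreeAtMost (maxDegree G) (endOn s)
    endOn-degree s v h h-injective at-v = ℕ.1+n≰n (ℕ.≤-trans
      (injection⇒≤degree h h-injective
        (λ i → subst (_isEndOf h i within G) (at-v i) (endOn-isEnd s (h i))))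
      (degree≤maxDegree v))

    adjacent⇒meet : ∀ {e f} → Adjacent G e f →
      endOn true e ≡ endOn true f ⊎ endOn false e ≡ endOn false f
    adjacent⇒meet (v , v∈e , v∈f)
      with side v | trans (endOn-unique v∈e) (sym (endOn-unique v∈f))
    ... | true | eq = inj₁ eq
    ... | false | eq = inj₂ eq

    meet⇒adjacent : ∀ {e f} →
      endOn true e ≡ endOn true f ⊎ endOn false e ≡ endOn false f → Adjacent G e f
    meet⇒adjacent {e} {f} = [ common true , common false ]′
      where
      common : ∀ s → endOn s e ≡ endOn s f → Adjacent G e f
      common s eq = endOn s e , endOn-isEnd s e ,
        subst (_isEndOf f within G) (sym eq) (endOn-isEnd s f)

theorem1p5 : ∀ {n m} (G : Multigraph n m) → Bipartite G →
    (pre : Fin m → Maybe (Fin (suc (maxDegree G)))) →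
    PrecolouredIsMatching G pre →
    Σ (Fin m → Fin (suc (maxDegree G))) λ c →
    ProperEdgeColouring G c × Extends c pre
theorem1p5 G bipartite pre isMatching
  with extendMatching (endOn G bipartite true) (endOn G bipartite false) pre
         (λ {e} {f} pe pf meets → decidable-stable (e ≟ f)
           (λ e≢f → isMatching e f pe pf e≢f (meet⇒adjacent G bipartite meets)))
         (proj₂ (admissibleColouring (endOn-degree G bipartite true) (endOn-degree G bipartite false)
           (precoloured? pre)))
... | c , proper , extends =
  c , (λ e f e≢f adjacent → e≢f ∘ proper (adjacent⇒meet G bipartite adjacent)) , extends
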